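{- Fix $\varepsilon,\delta\in(0,1)$ and a constant $c>0$. For every $\eta\in(0,1)$ and every $N\in\mathbb{N}$ there exist a dataset $V$ with $n=|V|\ge N$ elements in a metric space and a $2$-clustering $\mathcal{C}=\{C_1,C_2\}$ of $V$ such that the uniform-sampling algorithm described in the context, run on $V$ and $\mathcal{C}$ with expected per-cluster sample size $t=\lceil c\,\varepsilon^{ -2}\ln(5nk/\delta)\rceil$, $k=2$, returns, with probability at least $1-\eta$, a set of estimates $\{(e,\widehat{s}(e)) : e\in V\}$ such that $$|\widehat{s}(e')-s(e')|\ge 1\quad\text{for at least } \tfrac{n}{2}-1 \text{ elements } e'\in V,$$ where $s(e')$ is the silhouette of $e'$ with respect to $\mathcal{C}$.
   Context: A dataset is a finite set $V$ of $n$ distinct elements of a metric space $(U,d)$. A $k$-clustering $\mathcal{C}=\{C_1,\dots,C_k\}$ of $V$ is a partition of $V$ into $k$ disjoint nonempty subsets (clusters). For $e\in V$ belonging to cluster $C$ with $|C|\ge 2$, let $a(e)=\frac{1}{|C|-1}\sum_{e'\in C}d(e,e')$ and $b(e)=\min_{C_j\in\mathcal{C},\,C_j\ne C}\frac{1}{|C_j|}\sum_{e'\in C_j}d(e,e')$. The silhouette of $e$ is $s(e)=\frac{b(e)-a(e)}{\max\{a(e),b(e)\}}$; if $C=\{e\}$, then $s(e)=0$. Uniform-sampling algorithm (with sample-size parameter $t$). For each cluster $C_j$, let $p_j=\min\{1,t/|C_j|\}$ and form a random sample $S_{C_j}\subseteq C_j$ by including each element of $C_j$ independently with probability $p_j$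 (independently across clusters). For each $e\in V$ and each $j$ set $\widehat{W}_{C_j}(e)=\sum_{e'\in S_{C_j}}d(e,e')/p_j$. For $e$ in cluster $C$ with $|C|\ge2$ set $\widehat{a}(e)=\widehat{W}_{C}(e)/(|C|-1)$, $\widehat{b}(e)=\min_{C_j\ne C}\widehat{W}_{C_j}(e)/|C_j|$ and $\widehat{s}(e)=\frac{\widehat{b}(e)-\widehat{a}(e)}{\max\{\widehat{a}(e),\widehat{b}(e)\}}$ (with $\widehat{s}(e)=0$ if the denominator is $0$ or if $C=\{e\}$). -}

module Defs where

open import Level using (0ℓ) renaming (suc to lsuc)
open import Data.Nat.Base as ℕ using (ℕ; zero; suc; z≤n; s≤s)
open import Data.Nat using (_!)
import Data.Nat.Properties as ℕₚ
open import Data.Bool.Base using (if_then_else_)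
open import Data.Fin.Base using (Fin; zero; suc; toℕ; punchIn)
open import Data.Fin.Subset using (Subset; Nonempty; inside; outside; _∈_; _∩_)
  renaming (∣_∣ to card)
open import Data.Vec.Base as Vec using ([]; _∷_; lookup)
open import Data.Vec.Functional as Vector using (Vector; head; tail)
open import Data.Product.Base using (∃; _×_; _,_; proj₁; proj₂)
open import Data.Sum.Base using (inj₁; inj₂)
open import Data.Empty using (⊥-elim)
open import Algebra.Bundles using (CommutativeRing; Semiring)
open import Algebra.Core using (Op₁; Op₂)
import Algebra.Definitions.RawSemiring as RawSemiringDefs
import Algebra.Construct.NaturalChoice.Min as NaturalMin
import Algebra.Construct.NaturalChoice.Max as NaturalMax
import Algebra.Properties.Ring as RingProperties
open import Function.Base using (_∘_)
open import Function.Metric.Core using (DistanceFunction)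
open import Function.Metric.Structures using (IsGeneralMetric)
open import Relation.Binary.Bundles using (TotalOrder)
open import Relation.Binary.Core using (Rel)
open import Relation.Binary.Structures using (IsDecTotalOrder)
import Relation.Binary.Construct.NonStrictToStrict as ToStrict
import Relation.Binary.Reasoning.Setoid as SetoidReasoning
open import Relation.Binary.PropositionalEquality.Core using (_≡_)
open import Relation.Nullary using (¬_; yes; no; does)
open import Relation.Unary using (Pred; Decidable)

------------------------------------------------------------------------
-- The real numbers, as a complete ordered field

-- The order is taken to be decidable, as it is classically.  The
-- Archimedean property follows from completeness only by an argument by
-- contradiction, so its witness is asked for explicitly.

record CompleteOrderedField : Set₁ where
  field
    commutativeRing : CommutativeRing 0ℓ 0ℓ

  open CommutativeRing commutativeRing public hiding (zero)

  open Semiring semiring public using (rawSemiring)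

  private
    module RS = RawSemiringDefs rawSemiring

  fromℕ : ℕ → Carrier
  fromℕ n = n RS.× 1#

  infix 4 _≤_
  field
    0≉1             : ¬ (0# ≈ 1#)
    invertible      : ∀ x → ¬ (x ≈ 0#) → ∃ λ y → x * y ≈ 1#
    _≤_             : Rel Carrier 0ℓ
    isDecTotalOrder : IsDecTotalOrder _≈_ _≤_
    +-monoˡ-≤       : ∀ z {x y} → x ≤ y → x + z ≤ y + z
    *-nonNegative   : ∀ {x y} → 0# ≤ x → 0# ≤ y → 0# ≤ x * y

  IsUpperBound : Pred Carrier 0ℓ → Carrier → Set
  IsUpperBound P b = ∀ x → P x → x ≤ b

  IsSupremum : Pred Carrier 0ℓ → Carrier → Set
  IsSupremum P s = IsUpperBound P s × (∀ b → IsUpperBound P b → s ≤ b)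

  field
    complete        : (P : Pred Carrier 0ℓ) → ∃ P → ∃ (IsUpperBound P) →
                      ∃ (IsSupremum P)
    archimedean     : ∀ x → ∃ λ n → x ≤ fromℕ n

module Reals (R : CompleteOrderedField) where

  open CompleteOrderedField R public renaming (Carrier to ℝ)
  open RawSemiringDefs rawSemiring public using (_^_; sum; product)
  open IsDecTotalOrder isDecTotalOrder public
    using (_≟_; _≤?_; isTotalOrder; ≤-respˡ-≈; ≤-respʳ-≈)
    renaming ( total to ≤-total; antisym to ≤-antisym; trans to ≤-trans
             ; reflexive to ≤-reflexive )

  totalOrder : TotalOrder 0ℓ 0ℓ 0ℓ
  totalOrder = record { isTotalOrder = isTotalOrder }

  open ToStrict _≈_ _≤_ public using (_<_)
  open NaturalMin totalOrder public using (_⊓_)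
  open NaturalMax totalOrder public using (_⊔_)

  ∣_∣ : Op₁ ℝ
  ∣ x ∣ = x ⊔ (- x)

  minimum : ∀ {m} → Vector ℝ (suc m) → ℝ
  minimum f = Vector.foldr _⊓_ (head f) (tail f)

  -- Total, with 0⁻¹ = 0, so that x / 0 = 0.
  infix 9 _⁻¹
  _⁻¹ : Op₁ ℝ
  x ⁻¹ with x ≟ 0#
  ... | yes _   = 0#
  ... | no  x≉0 = proj₁ (invertible x x≉0)

  infixl 7 _/_
  _/_ : Op₂ ℝ
  x / y = x * y ⁻¹

  *-inverseʳ : ∀ x → ¬ (x ≈ 0#) → x * x ⁻¹ ≈ 1#
  *-inverseʳ x x≉0 with x ≟ 0#
  ... | yes x≈0 = ⊥-elim (x≉0 x≈0)
  ... | no  nz  = proj₂ (invertible x nz)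

  -- The least natural number above x; it is the usual ceiling
  -- whenever x > -1.
  ceilBelow : ℝ → ℕ → ℕ
  ceilBelow x zero    = zero
  ceilBelow x (suc m) = if does (x ≤? fromℕ m) then ceilBelow x m else suc m

  ⌈_⌉ : ℝ → ℕ
  ⌈ x ⌉ = ceilBelow x (proj₁ (archimedean x))

  infix 4 _⟶_
  _⟶_ : (ℕ → ℝ) → ℝ → Set
  s ⟶ z = ∀ ε → 0# < ε → ∃ λ N → ∀ n → N ℕ.≤ n → ∣ s n - z ∣ < ε

  expTerm : ℝ → ℕ → ℝ
  expTerm y i = y ^ i / fromℕ (i !)

  expSum : ℝ → ℕ → ℝ
  expSum y n = sum {n} (λ i → expTerm y (toℕ i))

  -- e^y ≤ x
  Exp≤ : ℝ → Pred ℝ 0ℓ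
  Exp≤ x y = ∃ λ z → expSum y ⟶ z × z ≤ x

  private
    open RingProperties ring using (-0#≈0#; -‿involutive; -‿distribʳ-*)
    open SetoidReasoning setoid

    ≤-refl : ∀ {x} → x ≤ x
    ≤-refl = ≤-reflexive refl

    ≤-cong : ∀ {x x′ y y′} → x ≈ x′ → y ≈ y′ → x ≤ y → x′ ≤ y′
    ≤-cong p q x≤y = ≤-respˡ-≈ p (≤-respʳ-≈ q x≤y)

    +-mono-≤ : ∀ {x y u v} → x ≤ y → u ≤ v → x + u ≤ y + v
    +-mono-≤ {x} {y} {u} {v} x≤y u≤v = ≤-trans (+-monoˡ-≤ u x≤y)
      (≤-cong (+-comm u y) (+-comm v y) (+-monoˡ-≤ y u≤v))

    neg-nonneg : ∀ {x} → x ≤ 0# → 0# ≤ - x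
    neg-nonneg {x} x≤0 =
      ≤-cong (-‿inverseʳ x) (+-identityˡ (- x)) (+-monoˡ-≤ (- x) x≤0)

    0≤1 : 0# ≤ 1#
    0≤1 with ≤-total 0# 1#
    ... | inj₁ p = p
    ... | inj₂ p = ≤-respʳ-≈ eq (*-nonNegative 0≤-1 0≤-1)
      where
      0≤-1 = neg-nonneg p
      eq : - 1# * - 1# ≈ 1#
      eq = begin
        - 1# * - 1#    ≈⟨ -‿distribʳ-* (- 1#) 1# ⟨
        - (- 1# * 1#)  ≈⟨ -‿cong (*-identityʳ (- 1#)) ⟩
        - - 1#         ≈⟨ -‿involutive 1# ⟩
        1#             ∎

    0≤⁻¹ : ∀ {x} → 0# ≤ x → 0# ≤ x ⁻¹
    0≤⁻¹ {x} 0≤x with x ≟ 0#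
    ... | yes _   = ≤-refl
    ... | no  x≉0 with invertible x x≉0
    ...   | y , xy≈1 with ≤-total 0# y
    ...     | inj₁ p = p
    ...     | inj₂ p = ⊥-elim (0≉1 (≤-antisym 0≤1 1≤0))
      where
      0≤-1 : 0# ≤ - 1#
      0≤-1 = ≤-respʳ-≈ (trans (sym (-‿distribʳ-* x y)) (-‿cong xy≈1))
               (*-nonNegative 0≤x (neg-nonneg p))
      1≤0 : 1# ≤ 0#
      1≤0 = ≤-cong (+-identityˡ 1#) (-‿inverseˡ 1#) (+-monoˡ-≤ 1# 0≤-1)

    0≤fromℕ : ∀ n → 0# ≤ fromℕ n
    0≤fromℕ zero    = ≤-refl
    0≤fromℕ (suc n) = ≤-respˡ-≈ (+-identityʳ 0#) (+-mono-≤ 0≤1 (0≤fromℕ n))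

    0≤^ : ∀ {y} n → 0# ≤ y → 0# ≤ y ^ n
    0≤^ zero    p = 0≤1
    0≤^ (suc n) p = *-nonNegative p (0≤^ n p)

    0≤sum : ∀ {n} (f : Vector ℝ n) → (∀ i → 0# ≤ f i) → 0# ≤ sum f
    0≤sum {zero}  f p = ≤-refl
    0≤sum {suc n} f p =
      ≤-respˡ-≈ (+-identityʳ 0#) (+-mono-≤ (p zero) (0≤sum (tail f) (p ∘ suc)))

    sum≈0 : ∀ {n} (f : Vector ℝ n) → (∀ i → f i ≈ 0#) → sum f ≈ 0#
    sum≈0 {zero}  f p = refl
    sum≈0 {suc n} f p =
      trans (+-cong (p zero) (sum≈0 (tail f) (p ∘ suc))) (+-identityʳ 0#)

    fromℕ1≉0 : ¬ (fromℕ 1 ≈ 0#)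
    fromℕ1≉0 p = 0≉1 (trans (sym p) (+-identityʳ 1#))

    1/1≈1 : 1# / fromℕ 1 ≈ 1#
    1/1≈1 = trans (*-congʳ (sym (+-identityʳ 1#))) (*-inverseʳ _ fromℕ1≉0)

    expTerm₁ : ∀ y → expTerm y 1 ≈ y
    expTerm₁ y = begin
      (y * 1#) * fromℕ 1 ⁻¹  ≈⟨ *-assoc y 1# _ ⟩
      y * (1# / fromℕ 1)     ≈⟨ *-congˡ 1/1≈1 ⟩
      y * 1#                 ≈⟨ *-identityʳ y ⟩
      y                      ∎

    expSum-0 : ∀ n → expSum 0# (suc n) ≈ 1#
    expSum-0 n = trans
      (+-cong 1/1≈1 (sum≈0 {n} (λ i → expTerm 0# (suc (toℕ i)))
        (λ i → trans (*-congʳ (zeroˡ _)) (zeroˡ _))))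
      (+-identityʳ 1#)

    ∣x∣<ε : ∀ {x ε} → x ≈ 0# → 0# < ε → ∣ x ∣ < ε
    ∣x∣<ε {x} {ε} x≈0 (0≤ε , 0≉ε) =
      ≤-respˡ-≈ (sym eq) 0≤ε , (λ p → 0≉ε (trans (sym eq) p))
      where
      eq : ∣ x ∣ ≈ 0#
      eq with ≤-total (- x) x
      ... | inj₁ _ = x≈0
      ... | inj₂ _ = trans (-‿cong x≈0) -0#≈0#

    x≤∣x∣ : ∀ x → x ≤ ∣ x ∣
    x≤∣x∣ x with ≤-total (- x) x
    ... | inj₁ _ = ≤-refl
    ... | inj₂ p = p

    exp-0≤ : ∀ {x} → 1# ≤ x → Exp≤ x 0#
    exp-0≤ 1≤x = 1# , lim , 1≤x
      where
      lim : expSum 0# ⟶ 1#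
      lim ε 0<ε = 1 , λ { (suc n) _ →
        ∣x∣<ε (trans (+-congʳ (expSum-0 n)) (-‿inverseʳ 1#)) 0<ε }

    1+y≤expSum : ∀ {y} → 0# ≤ y → ∀ n → 1# + y ≤ expSum y (2 ℕ.+ n)
    1+y≤expSum {y} 0≤y n =
      ≤-cong (+-congˡ (+-identityʳ y))
        (+-cong (sym 1/1≈1) (+-congʳ (sym (expTerm₁ y))))
        (+-mono-≤ ≤-refl (+-mono-≤ ≤-refl
          (0≤sum {n} (λ i → expTerm y (suc (suc (toℕ i))))
            (λ i → *-nonNegative (0≤^ (suc (suc (toℕ i))) 0≤y)
                     (0≤⁻¹ (0≤fromℕ (suc (suc (toℕ i)) !)))))))

    exp-bounded : ∀ {x} → 1# ≤ x → IsUpperBound (Exp≤ x) x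
    exp-bounded {x} 1≤x y (z , lim , z≤x) with ≤-total y 0#
    ... | inj₁ y≤0 = ≤-trans y≤0 (≤-trans 0≤1 1≤x)
    ... | inj₂ 0≤y with lim 1# (0≤1 , 0≉1)
    ...   | N , near = ≤-trans y≤z z≤x
      where
      S = expSum y (2 ℕ.+ N)
      S-z≤1 : S - z ≤ 1#
      S-z≤1 = ≤-trans (x≤∣x∣ _) (proj₁ (near (2 ℕ.+ N) (ℕₚ.m≤n+m N 2)))
      S≤1+z : S ≤ 1# + z
      S≤1+z = ≤-respˡ-≈
        (trans (+-assoc S (- z) z)
          (trans (+-congˡ (-‿inverseˡ z)) (+-identityʳ S)))
        (+-monoˡ-≤ z S-z≤1)
      cancel : ∀ w → (1# + w) + - 1# ≈ w
      cancel w = begin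
        (1# + w) + - 1#  ≈⟨ +-congʳ (+-comm 1# w) ⟩
        (w + 1#) + - 1#  ≈⟨ +-assoc w 1# (- 1#) ⟩
        w + (1# - 1#)    ≈⟨ +-congˡ (-‿inverseʳ 1#) ⟩
        w + 0#           ≈⟨ +-identityʳ w ⟩
        w                ∎
      y≤z : y ≤ z
      y≤z = ≤-cong (cancel y) (cancel z)
        (+-monoˡ-≤ (- 1#) (≤-trans (1+y≤expSum 0≤y N) S≤1+z))

  ln≥1-supremum : ∀ x → 1# ≤ x → ∃ (IsSupremum (Exp≤ x))
  ln≥1-supremum x 1≤x =
    complete (Exp≤ x) (0# , exp-0≤ 1≤x) (x , exp-bounded 1≤x)

  ln≥1 : ∀ x → 1# ≤ x → ℝ
  ln≥1 x 1≤x = proj₁ (ln≥1-supremum x 1≤x)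

  -- ln x = sup { y | e^y ≤ x } for x ≥ 1, ln x = - ln (1/x) for 0 < x < 1,
  -- and the junk value 0 for x ≤ 0.
  ln : ℝ → ℝ
  ln x with 1# ≤? x | 1# ≤? x ⁻¹
  ... | yes 1≤x | _       = ln≥1 x 1≤x
  ... | no  _   | yes 1≤y = - ln≥1 (x ⁻¹) 1≤y
  ... | no  _   | no  _   = 0#

  ----------------------------------------------------------------------
  -- Independent sampling

  sumSubsets : ∀ n → (Subset n → ℝ) → ℝ
  sumSubsets zero    f = f []
  sumSubsets (suc n) f =
    sumSubsets n (f ∘ (inside ∷_)) + sumSubsets n (f ∘ (outside ∷_))

  weight : ∀ {n} → Vector ℝ n → Subset n → ℝ
  weight p S = product (λ e → if lookup S e then p e else 1# - p e)

  -- Probability of the event A for a random subset containing each e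
  -- independently with probability p e.
  ℙ : ∀ {n} → Vector ℝ n → {A : Pred (Subset n) 0ℓ} → Decidable A → ℝ
  ℙ {n} p A? = sumSubsets n (λ S → if does (A? S) then weight p S else 0#)

  ----------------------------------------------------------------------
  -- Datasets and clusterings

  record MetricSpace : Set₁ where
    infix 4 _≃_
    field
      Carrier  : Set
      _≃_      : Rel Carrier 0ℓ
      d        : DistanceFunction Carrier ℝ
      isMetric : IsGeneralMetric _≃_ _≈_ _≤_ 0# _+_ d

  record Dataset (U : MetricSpace) (n : ℕ) : Set where
    open MetricSpace U
    field
      point    : Fin n → Carrier
      distinct : ∀ {i j} → point i ≃ point j → i ≡ j

    dist : Fin n → Fin n → ℝ
    dist i j = d (point i) (point j)

  record Clustering (n k : ℕ) : Set where
    field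
      cluster  : Fin k → Subset n
      nonempty : ∀ j → Nonempty (cluster j)
      disjoint : ∀ {i j e} → e ∈ cluster i → e ∈ cluster j → i ≡ j
      covers   : ∀ e → ∃ λ j → e ∈ cluster j

    clusterOf : Fin n → Fin k
    clusterOf e = proj₁ (covers e)

    size : Fin k → ℕ
    size j = card (cluster j)

  sumOver : ∀ {n} → Subset n → Vector ℝ n → ℝ
  sumOver S f = sum (λ e → if lookup S e then f e else 0#)

  ----------------------------------------------------------------------
  -- Silhouettes

  module Silhouette {U n m} (V : Dataset U n) (C : Clustering n (2 ℕ.+ m)) where
    open Dataset V
    open Clustering C

    k : ℕ
    k = 2 ℕ.+ m

    -- Common to the exact and the estimated silhouette of e: W j is the
    -- exact, respectively estimated, sum of the distances from e to the
    -- j-th cluster.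
    module From (W : Fin k → ℝ) (e : Fin n) where
      c : Fin k
      c = clusterOf e

      a b value : ℝ
      a = W c / fromℕ (size c ℕ.∸ 1)
      -- punchIn c enumerates the clusters other than the c-th.
      b = minimum (λ i → W (punchIn c i) / fromℕ (size (punchIn c i)))
      value = if size c ℕ.≤ᵇ 1 then 0# else (b - a) / (a ⊔ b)

    W : Fin n → Fin k → ℝ
    W e j = sumOver (cluster j) (dist e)

    s : Fin n → ℝ
    s e = From.value (W e) e

    module Sampling (t : ℕ) where
      p : Fin k → ℝ
      p j = 1# ⊓ (fromℕ t / fromℕ (size j))

      -- The clusters partition the dataset, so the independent samples of
      -- the clusters amount to one subset S of the dataset, and the sample
      -- of the j-th cluster is its intersection with S.
      inclusion : Vector ℝ n
      inclusion e = p (clusterOf e)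

      Ŵ : Subset n → Fin n → Fin k → ℝ
      Ŵ S e j = sumOver (S ∩ cluster j) (λ e′ → dist e e′ / p j)

      ŝ : Subset n → Fin n → ℝ
      ŝ S e = From.value (Ŵ S e) e

      largeError : Subset n → Subset n
      largeError S = Vec.tabulate (λ e → does (1# ≤? ∣ ŝ S e - s e ∣))

      ManyLargeErrors : Pred (Subset n) 0ℓ
      ManyLargeErrors S = fromℕ n / fromℕ 2 - 1# ≤ fromℕ (card (largeError S))

      manyLargeErrors? : Decidable ManyLargeErrors
      manyLargeErrors? S = _ ≤? _

-- The first cluster consists of q points at mutual distance 1 and one very
-- remote outlier; the second is a single point at the intermediate distance D
-- from the q points.  The outlier dominates a(e), so that s(e) ≤ -1/2 for each
-- of the q points, whereas ŝ(e) ≥ 1/2 as soon as the outlier is not sampled,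
-- however the q points are sampled; the singleton cluster is sampled surely
-- since t ≥ 1.  The outlier is sampled with probability at most t / (q + 1),
-- which tends to 0 because t grows only logarithmically.

module Submission where

open import Defs
open import Level using (0ℓ)
open import Data.Nat.Base as ℕ using (ℕ; zero; suc)
open import Data.Nat using (_!)
import Data.Nat.Properties as ℕₚ
open import Data.Fin.Properties as Fin using (toℕ-inject₁; toℕ-fromℕ)
open import Data.Bool.Base using (Bool; true; false; if_then_else_)
open import Data.Fin.Base using (Fin; zero; suc; toℕ)
open import Data.Fin.Subset using (Subset; inside; outside; _∈_; _∩_; ⊤; ⊥)
  renaming (∣_∣ to card)
open import Data.Fin.Subset.Properties using (∉⊥; ∈⊤; ∣p∣≤∣x∷p∣; ∣⊥∣≡0; ∣⊤∣≡n)
open import Data.Vec.Base as Vec using ([]; _∷_; lookup; here; there)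
open import Data.Vec.Functional using (Vector; tail)
open import Data.Product.Base using (Σ-syntax; ∃; _×_; _,_; proj₁; proj₂)
open import Data.Sum.Base using (inj₁; inj₂)
open import Function.Base using (_∘_)
open import Relation.Binary.PropositionalEquality as ≡ using (_≡_)
open import Relation.Nullary using (¬_; yes; no; does; contradiction)
open import Relation.Nullary.Decidable using (dec-true; dec-false)
open import Relation.Unary using (Pred; Decidable)
import Algebra.Construct.NaturalChoice.Min as NaturalMin
import Algebra.Construct.NaturalChoice.Max as NaturalMax
import Algebra.Properties.CommutativeSemigroup as CommutativeSemigroupProperties
import Algebra.Properties.Ring as RingProperties
import Algebra.Properties.AbelianGroup as AbelianGroupProperties
import Algebra.Properties.Monoid.Sum as MonoidSum
import Algebra.Properties.Semiring.Mult as SemiringMult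
import Relation.Binary.Bundles as Bundles
import Relation.Binary.Construct.NonStrictToStrict as ToStrict
import Relation.Binary.Reasoning.PartialOrder as PartialOrderReasoning

-- The sample size t depends on the size of the very dataset it must fail on. Only two facts about
-- it are needed, t ≥ 1 and t ≤ η m with m = q + 1, and both rest on `ln`, which is given only as
-- the supremum of the exponents y with e^y ≤ x. The upper bound calls for a growth estimate of e^y.
-- The lower bound calls for an actual positive member of that set, hence for a proof that the
-- exponential series converges at some positive point. The point ½ is convenient: the terms there
-- are dominated by the powers of ½, and the limit is at most 2. No concentration argument enters. A
-- sampled point of the first cluster is scaled up by 1 / p, and 1 / p never exceeds m because the
-- expected sample size is at least 1. So without the outlier the estimate of a(e) stays below m for
-- every outcome of the other draws, and taking D proportional to the cluster size beats even the
-- worst outcome.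

m*[1+n]*o≤m*[2*o]*n : ∀ m n o → 1 ℕ.≤ n → m ℕ.* suc n ℕ.* o ℕ.≤ m ℕ.* (2 ℕ.* o) ℕ.* n
m*[1+n]*o≤m*[2*o]*n m n o 1≤n = begin
  m ℕ.* suc n ℕ.* o        ≤⟨ ℕₚ.*-monoˡ-≤ o (ℕₚ.*-monoʳ-≤ m 1+n≤2*n) ⟩
  m ℕ.* (2 ℕ.* n) ℕ.* o    ≡⟨ ℕₚ.*-assoc m (2 ℕ.* n) o ⟩
  m ℕ.* (2 ℕ.* n ℕ.* o)    ≡⟨ ≡.cong (m ℕ.*_) (xy∙z≈xz∙y 2 n o) ⟩
  m ℕ.* (2 ℕ.* o ℕ.* n)    ≡⟨ ℕₚ.*-assoc m (2 ℕ.* o) n ⟨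
  m ℕ.* (2 ℕ.* o) ℕ.* n    ∎
  where
  open ℕₚ.≤-Reasoning
  open CommutativeSemigroupProperties ℕₚ.*-commutativeSemigroup using (xy∙z≈xz∙y)
  1+n≤2*n : suc n ℕ.≤ 2 ℕ.* n
  1+n≤2*n = ℕₚ.+-mono-≤ 1≤n (ℕₚ.≤-reflexive (≡.sym (ℕₚ.+-identityʳ n)))

card-tabulate : ∀ {n} (f : Fin n → Bool) → (∀ i → f i ≡ inside) →
                n ℕ.≤ card (Vec.tabulate f)
card-tabulate {zero}  f f≡inside = ℕ.z≤n
card-tabulate {suc n} f f≡inside rewrite f≡inside zero =
  ℕ.s≤s (card-tabulate (f ∘ suc) (f≡inside ∘ suc))

-- Arithmetic of ordered fields, ceilings and finite sums.

module OrderedFieldProperties (R : CompleteOrderedField) where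

  open Reals R
  open RingProperties ring
    using (-0#≈0#; -‿distribʳ-*; -‿involutive; x[y-z]≈xy-xz)
  open PartialOrderReasoning (Bundles.TotalOrder.poset totalOrder) public
  open CommutativeSemigroupProperties *-commutativeSemigroup using (xy∙z≈xz∙y)
  open SemiringMult semiring using (×-homo-+; ×1-homo-*)

  ≤-refl : ∀ {x} → x ≤ x
  ≤-refl = ≤-reflexive refl

  ≰⇒> : ∀ {x y} → ¬ (x ≤ y) → y < x
  ≰⇒> = ToStrict.≰⇒> _≈_ _≤_ sym ≤-reflexive ≤-total

  +-mono-≤ : ∀ {x y u v} → x ≤ y → u ≤ v → x + u ≤ y + v
  +-mono-≤ {x} {y} {u} {v} x≤y u≤v = begin
    x + u  ≤⟨ +-monoˡ-≤ u x≤y ⟩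
    y + u  ≈⟨ +-comm y u ⟩
    u + y  ≤⟨ +-monoˡ-≤ y u≤v ⟩
    v + y  ≈⟨ +-comm v y ⟩
    y + v  ∎

  +-monoʳ-≤ : ∀ z {x y} → x ≤ y → z + x ≤ z + y
  +-monoʳ-≤ z = +-mono-≤ ≤-refl

  0≤+ : ∀ {x y} → 0# ≤ x → 0# ≤ y → 0# ≤ x + y
  0≤+ 0≤x 0≤y = ≤-respˡ-≈ (+-identityʳ 0#) (+-mono-≤ 0≤x 0≤y)

  x≤x+y : ∀ {x y} → 0# ≤ y → x ≤ x + y
  x≤x+y {x} 0≤y = ≤-respˡ-≈ (+-identityʳ x) (+-monoʳ-≤ x 0≤y)

  x≤y+x : ∀ {x y} → 0# ≤ y → x ≤ y + x
  x≤y+x {x} {y} 0≤y = ≤-respʳ-≈ (+-comm x y) (x≤x+y 0≤y)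

  [x-y]+y≈x : ∀ x y → (x - y) + y ≈ x
  [x-y]+y≈x x y = trans (+-assoc x (- y) y)
    (trans (+-congˡ (-‿inverseˡ y)) (+-identityʳ x))

  [x+y]-y≈x : ∀ x y → (x + y) - y ≈ x
  [x+y]-y≈x x y = trans (+-assoc x y (- y))
    (trans (+-congˡ (-‿inverseʳ y)) (+-identityʳ x))

  x≤z+y⇒x-y≤z : ∀ {x y z} → x ≤ z + y → x - y ≤ z
  x≤z+y⇒x-y≤z {x} {y} {z} p = ≤-respʳ-≈ ([x+y]-y≈x z y) (+-monoˡ-≤ (- y) p)

  x+y≤z⇒x≤z-y : ∀ {x y z} → x + y ≤ z → x ≤ z - y
  x+y≤z⇒x≤z-y {x} {y} {z} p = ≤-respˡ-≈ ([x+y]-y≈x x y) (+-monoˡ-≤ (- y) p)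

  x≤y⇒0≤y-x : ∀ {x y} → x ≤ y → 0# ≤ y - x
  x≤y⇒0≤y-x {x} x≤y = x+y≤z⇒x≤z-y (≤-respˡ-≈ (sym (+-identityˡ x)) x≤y)

  0≤y-x⇒x≤y : ∀ {x y} → 0# ≤ y - x → x ≤ y
  0≤y-x⇒x≤y {x} {y} p =
    ≤-respˡ-≈ (+-identityˡ x) (≤-respʳ-≈ ([x-y]+y≈x y x) (+-monoˡ-≤ x p))

  neg-antimono-≤ : ∀ {x y} → x ≤ y → - y ≤ - x
  neg-antimono-≤ {x} {y} x≤y =
    ≤-respʳ-≈ (+-identityˡ (- x)) (x+y≤z⇒x≤z-y (≤-respˡ-≈ (+-comm x (- y))
      (x≤z+y⇒x-y≤z (≤-respʳ-≈ (sym (+-identityˡ y)) x≤y))))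

  *-monoˡ-≤ : ∀ {z} → 0# ≤ z → ∀ {x y} → x ≤ y → z * x ≤ z * y
  *-monoˡ-≤ {z} 0≤z {x} {y} x≤y = 0≤y-x⇒x≤y
    (≤-respʳ-≈ (x[y-z]≈xy-xz z y x) (*-nonNegative 0≤z (x≤y⇒0≤y-x x≤y)))

  *-monoʳ-≤ : ∀ {z} → 0# ≤ z → ∀ {x y} → x ≤ y → x * z ≤ y * z
  *-monoʳ-≤ {z} 0≤z {x} {y} x≤y =
    ≤-respˡ-≈ (*-comm z x) (≤-respʳ-≈ (*-comm z y) (*-monoˡ-≤ 0≤z x≤y))

  *-mono-≤ : ∀ {x y u v} → 0# ≤ x → 0# ≤ v → x ≤ y → u ≤ v → x * u ≤ y * v
  *-mono-≤ 0≤x 0≤v x≤y u≤v = ≤-trans (*-monoˡ-≤ 0≤x u≤v) (*-monoʳ-≤ 0≤v x≤y)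

  0≤1 : 0# ≤ 1#
  0≤1 with ≤-total 0# 1#
  ... | inj₁ p = p
  ... | inj₂ p = begin
    0#             ≤⟨ *-nonNegative 0≤-1 0≤-1 ⟩
    - 1# * - 1#    ≈⟨ -‿distribʳ-* (- 1#) 1# ⟨
    - (- 1# * 1#)  ≈⟨ -‿cong (*-identityʳ (- 1#)) ⟩
    - - 1#         ≈⟨ -‿involutive 1# ⟩
    1#             ∎
    where
    0≤-1 : 0# ≤ - 1#
    0≤-1 = ≤-respˡ-≈ -0#≈0# (neg-antimono-≤ p)

  0<1 : 0# < 1#
  0<1 = 0≤1 , 0≉1

  <⇒≉0 : ∀ {x} → 0# < x → ¬ (x ≈ 0#)
  <⇒≉0 (_ , 0≉x) = 0≉x ∘ sym

  <-≤-trans : ∀ {x y} → 0# < x → x ≤ y → 0# < y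
  <-≤-trans 0<x x≤y = begin-strict 0# <⟨ 0<x ⟩ _ ≤⟨ x≤y ⟩ _ ∎

  ⁻¹-inverseʳ : ∀ {x} → 0# < x → x * x ⁻¹ ≈ 1#
  ⁻¹-inverseʳ 0<x = *-inverseʳ _ (<⇒≉0 0<x)

  ⁻¹-inverseˡ : ∀ {x} → 0# < x → x ⁻¹ * x ≈ 1#
  ⁻¹-inverseˡ 0<x = trans (*-comm _ _) (⁻¹-inverseʳ 0<x)

  *-positive : ∀ {x y} → 0# < x → 0# < y → 0# < x * y
  *-positive {x} {y} 0<x 0<y =
    *-nonNegative (proj₁ 0<x) (proj₁ 0<y) , λ 0≈xy → proj₂ 0<y (begin-equality
      0#               ≈⟨ zeroʳ (x ⁻¹) ⟨
      x ⁻¹ * 0#        ≈⟨ *-congˡ 0≈xy ⟩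
      x ⁻¹ * (x * y)   ≈⟨ *-assoc (x ⁻¹) x y ⟨
      (x ⁻¹ * x) * y   ≈⟨ *-congʳ (⁻¹-inverseˡ 0<x) ⟩
      1# * y           ≈⟨ *-identityˡ y ⟩
      y                ∎)

  ⁻¹-positive : ∀ {x} → 0# < x → 0# < x ⁻¹
  ⁻¹-positive {x} 0<x = 0≤x⁻¹ , λ 0≈x⁻¹ → 0≉1
      (trans (sym (zeroʳ x)) (trans (*-congˡ 0≈x⁻¹) (⁻¹-inverseʳ 0<x)))
    where
    0≤x⁻¹ : 0# ≤ x ⁻¹
    0≤x⁻¹ with ≤-total 0# (x ⁻¹)
    ... | inj₁ p = p
    ... | inj₂ p = contradiction (≤-antisym 0≤1 (begin
      1#        ≈⟨ ⁻¹-inverseʳ 0<x ⟨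
      x * x ⁻¹  ≤⟨ *-monoˡ-≤ (proj₁ 0<x) p ⟩
      x * 0#    ≈⟨ zeroʳ x ⟩
      0#        ∎)) 0≉1

  *-⁻¹-cancelʳ : ∀ {z} x → 0# < z → x * z / z ≈ x
  *-⁻¹-cancelʳ {z} x 0<z = trans (*-assoc x z (z ⁻¹))
    (trans (*-congˡ (⁻¹-inverseʳ 0<z)) (*-identityʳ x))

  /-*-cancelʳ : ∀ {z} x → 0# < z → x / z * z ≈ x
  /-*-cancelʳ {z} x 0<z = trans (*-assoc x (z ⁻¹) z)
    (trans (*-congˡ (⁻¹-inverseˡ 0<z)) (*-identityʳ x))

  /-monoˡ-≤ : ∀ {z} → 0# < z → ∀ {x y} → x ≤ y → x / z ≤ y / z
  /-monoˡ-≤ 0<z = *-monoʳ-≤ (proj₁ (⁻¹-positive 0<z))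

  x≤y*z⇒x/z≤y : ∀ {x y z} → 0# < z → x ≤ y * z → x / z ≤ y
  x≤y*z⇒x/z≤y {y = y} 0<z p = ≤-respʳ-≈ (*-⁻¹-cancelʳ y 0<z) (/-monoˡ-≤ 0<z p)

  x*z≤y⇒x≤y/z : ∀ {x y z} → 0# < z → x * z ≤ y → x ≤ y / z
  x*z≤y⇒x≤y/z {x = x} 0<z p = ≤-respˡ-≈ (*-⁻¹-cancelʳ x 0<z) (/-monoˡ-≤ 0<z p)

  x/z≤y⇒x≤y*z : ∀ {x y z} → 0# < z → x / z ≤ y → x ≤ y * z
  x/z≤y⇒x≤y*z {x = x} 0<z p =
    ≤-respˡ-≈ (/-*-cancelʳ x 0<z) (*-monoʳ-≤ (proj₁ 0<z) p)

  *-cancelʳ-≤ : ∀ {x y z} → 0# < z → x * z ≤ y * z → x ≤ y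
  *-cancelʳ-≤ {y = y} 0<z p = ≤-respʳ-≈ (*-⁻¹-cancelʳ y 0<z) (x*z≤y⇒x≤y/z 0<z p)

  fromℕ-+ : ∀ m n → fromℕ (m ℕ.+ n) ≈ fromℕ m + fromℕ n
  fromℕ-+ = ×-homo-+ 1#

  fromℕ-* : ∀ m n → fromℕ (m ℕ.* n) ≈ fromℕ m * fromℕ n
  fromℕ-* = ×1-homo-*

  fromℕ-1 : fromℕ 1 ≈ 1#
  fromℕ-1 = +-identityʳ 1#

  fromℕ-2 : fromℕ 2 ≈ 1# + 1#
  fromℕ-2 = +-congˡ fromℕ-1

  0≤fromℕ : ∀ n → 0# ≤ fromℕ n
  0≤fromℕ zero    = ≤-refl
  0≤fromℕ (suc n) = 0≤+ 0≤1 (0≤fromℕ n)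

  fromℕ-mono-≤ : ∀ {m n} → m ℕ.≤ n → fromℕ m ≤ fromℕ n
  fromℕ-mono-≤ {n = n} ℕ.z≤n   = 0≤fromℕ n
  fromℕ-mono-≤         (ℕ.s≤s p) = +-monoʳ-≤ 1# (fromℕ-mono-≤ p)

  1≤fromℕ : ∀ {n} → 1 ℕ.≤ n → 1# ≤ fromℕ n
  1≤fromℕ {n} 1≤n = ≤-respˡ-≈ fromℕ-1 (fromℕ-mono-≤ {1} {n} 1≤n)

  0<fromℕ : ∀ {n} → 1 ℕ.≤ n → 0# < fromℕ n
  0<fromℕ {n} 1≤n = <-≤-trans 0<1 (1≤fromℕ {n} 1≤n)

  fromℕ≈0⇒≡0 : ∀ n → fromℕ n ≈ 0# → n ≡ 0
  fromℕ≈0⇒≡0 zero    _ = ≡.refl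
  fromℕ≈0⇒≡0 (suc n) p = contradiction p (<⇒≉0 (0<fromℕ {suc n} (ℕ.s≤s ℕ.z≤n)))

  x/1≈x : ∀ x → x / fromℕ 1 ≈ x
  x/1≈x x = begin-equality
    x / fromℕ 1            ≈⟨ *-congʳ (*-identityʳ x) ⟨
    x * 1# / fromℕ 1       ≈⟨ *-congʳ (*-congˡ fromℕ-1) ⟨
    x * fromℕ 1 / fromℕ 1  ≈⟨ *-⁻¹-cancelʳ x (0<fromℕ {1} ℕₚ.≤-refl) ⟩
    x                      ∎

  ½ : ℝ
  ½ = fromℕ 2 ⁻¹

  0<2 : 0# < fromℕ 2
  0<2 = 0<fromℕ {2} (ℕ.s≤s ℕ.z≤n)

  0<½ : 0# < ½
  0<½ = ⁻¹-positive 0<2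

  *2≈ : ∀ x → x * fromℕ 2 ≈ x + x
  *2≈ x = trans (*-congˡ fromℕ-2)
    (trans (distribˡ x 1# 1#) (+-cong (*-identityʳ x) (*-identityʳ x)))

  ½+½≈1 : ½ + ½ ≈ 1#
  ½+½≈1 = trans (sym (*2≈ ½)) (⁻¹-inverseˡ 0<2)

  ½x+½x≈x : ∀ x → ½ * x + ½ * x ≈ x
  ½x+½x≈x x = trans (sym (distribʳ x ½ ½)) (trans (*-congʳ ½+½≈1) (*-identityˡ x))

  ceilBelow-≥ : ∀ x m → x ≤ fromℕ m → x ≤ fromℕ (ceilBelow x m)
  ceilBelow-≥ x zero    x≤m = x≤m
  ceilBelow-≥ x (suc m) x≤1+m with x ≤? fromℕ m
  ... | yes x≤m = ceilBelow-≥ x m x≤m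
  ... | no  _   = x≤1+m

  -- The descent stops at a successor only if its predecessor lies below `x`, so it overshoots by
  -- less than one; stopping at zero is covered by `0# ≤ x`.
  ceilBelow-≤ : ∀ x m → 0# ≤ x → fromℕ (ceilBelow x m) ≤ 1# + x
  ceilBelow-≤ x zero    0≤x = 0≤+ 0≤1 0≤x
  ceilBelow-≤ x (suc m) 0≤x with x ≤? fromℕ m
  ... | yes _   = ceilBelow-≤ x m 0≤x
  ... | no  x≰m = +-monoʳ-≤ 1# (proj₁ (≰⇒> x≰m))

  ⌈⌉-≤ : ∀ x → 0# ≤ x → fromℕ ⌈ x ⌉ ≤ 1# + x
  ⌈⌉-≤ x = ceilBelow-≤ x (proj₁ (archimedean x))

  ⌈⌉-positive : ∀ x → 0# < x → 1 ℕ.≤ ⌈ x ⌉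
  ⌈⌉-positive x 0<x = positive ⌈ x ⌉
    (<-≤-trans 0<x (ceilBelow-≥ x (proj₁ (archimedean x)) (proj₂ (archimedean x))))
    where
    positive : ∀ n → 0# < fromℕ n → 1 ℕ.≤ n
    positive zero    (_ , 0≉0) = contradiction refl 0≉0
    positive (suc n) _         = ℕ.s≤s ℕ.z≤n

  x≤∣x∣ : ∀ x → x ≤ ∣ x ∣
  x≤∣x∣ x = NaturalMax.x≤x⊔y totalOrder x (- x)

  ∣∣-≤ : ∀ {x z} → x ≤ z → - x ≤ z → ∣ x ∣ ≤ z
  ∣∣-≤ = NaturalMax.⊔-lub totalOrder

  x≤y⇒x≤y/δ : ∀ {x y δ} → 0# < δ → δ ≤ 1# → 0# ≤ x → x ≤ y → x ≤ y / δ
  x≤y⇒x≤y/δ {x} 0<δ δ≤1 0≤x x≤y = x*z≤y⇒x≤y/z 0<δ (≤-trans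
    (≤-respʳ-≈ (*-identityʳ x) (*-monoˡ-≤ 0≤x δ≤1)) x≤y)

  fromℕ/δ-≤ : ∀ {k δ} a m → 0# < δ → k ℕ.≤ a ℕ.* m → fromℕ k / δ ≤ fromℕ a / δ * fromℕ m
  fromℕ/δ-≤ {k} {δ} a m 0<δ k≤am = begin
    fromℕ k / δ               ≤⟨ /-monoˡ-≤ 0<δ (fromℕ-mono-≤ k≤am) ⟩
    fromℕ (a ℕ.* m) / δ       ≈⟨ *-congʳ (fromℕ-* a m) ⟩
    fromℕ a * fromℕ m / δ     ≈⟨ xy∙z≈xz∙y (fromℕ a) (fromℕ m) (δ ⁻¹) ⟩
    fromℕ a / δ * fromℕ m     ∎

  0≤sum : ∀ {n} (f : Vector ℝ n) → (∀ i → 0# ≤ f i) → 0# ≤ sum f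
  0≤sum {zero}  f 0≤f = ≤-refl
  0≤sum {suc n} f 0≤f = 0≤+ (0≤f zero) (0≤sum (tail f) (0≤f ∘ suc))

  sum-≤ : ∀ {n} {f : Vector ℝ n} {z} → (∀ i → f i ≤ z) → sum f ≤ fromℕ n * z
  sum-≤ {zero}  {z = z}     f≤z = ≤-reflexive (sym (zeroˡ z))
  sum-≤ {suc n} {f} {z} f≤z = begin
    f zero + sum (tail f)      ≤⟨ +-mono-≤ (f≤z zero) (sum-≤ {n} {tail f} (f≤z ∘ suc)) ⟩
    z + fromℕ n * z            ≈⟨ +-congʳ (*-identityˡ z) ⟨
    1# * z + fromℕ n * z       ≈⟨ distribʳ z 1# (fromℕ n) ⟨
    (1# + fromℕ n) * z         ∎

  0≤sumOver : ∀ {n} (S : Subset n) {f : Vector ℝ n} →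
              (∀ i → 0# ≤ f i) → 0# ≤ sumOver S f
  0≤sumOver {n} S {f} 0≤f = 0≤sum {n} (λ i → if lookup S i then f i else 0#) summand
    where
    summand : ∀ i → 0# ≤ (if lookup S i then f i else 0#)
    summand i with lookup S i
    ... | true  = 0≤f i
    ... | false = ≤-refl

  sumOver-≤ : ∀ {n} (S : Subset n) {f : Vector ℝ n} {z} → 0# ≤ z →
              (∀ i → f i ≤ z) → sumOver S f ≤ fromℕ n * z
  sumOver-≤ {n} S {f} {z} 0≤z f≤z = sum-≤ {n} {λ i → if lookup S i then f i else 0#} summand
    where
    summand : ∀ i → (if lookup S i then f i else 0#) ≤ z
    summand i with lookup S i
    ... | true  = f≤z i
    ... | false = 0≤z

  sumOver-⊥ : ∀ n (f : Vector ℝ n) → sumOver ⊥ f ≈ 0#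
  sumOver-⊥ zero    f = refl
  sumOver-⊥ (suc n) f = trans (+-identityˡ _) (sumOver-⊥ n (tail f))

-- Growth and positivity of the logarithm.

module Logarithm (R : CompleteOrderedField) where

  open Reals R
  open OrderedFieldProperties R
  open AbelianGroupProperties +-abelianGroup using (⁻¹-anti-homo‿-; x∙y⁻¹≈ε⇒x≈y)
  open CommutativeSemigroupProperties *-commutativeSemigroup using (x∙yz≈y∙xz)
  open MonoidSum +-monoid using (sum-init-last; sum-cong-≋)

  ln-isSupremum : ∀ x → 1# ≤ x → IsSupremum (Exp≤ x) (ln x)
  ln-isSupremum x 1≤x with 1# ≤? x | 1# ≤? x ⁻¹
  ... | yes p  | _ = proj₂ (ln≥1-supremum x p)
  ... | no 1≰x | _ = contradiction 1≤x 1≰x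

  0≤^ : ∀ {y} n → 0# ≤ y → 0# ≤ y ^ n
  0≤^ zero    _   = 0≤1
  0≤^ (suc n) 0≤y = *-nonNegative 0≤y (0≤^ n 0≤y)

  0<! : ∀ n → 0# < fromℕ (n !)
  0<! n = 0<fromℕ {n !} (ℕₚ.1≤n! n)

  0≤expTerm : ∀ {y} → 0# ≤ y → ∀ n → 0# ≤ expTerm y n
  0≤expTerm 0≤y n = *-nonNegative (0≤^ n 0≤y) (proj₁ (⁻¹-positive (0<! n)))

  expSum-suc : ∀ y n → expSum y (suc n) ≈ expSum y n + expTerm y n
  expSum-suc y n = trans (sum-init-last {n} (λ i → expTerm y (toℕ i)))
    (+-cong (sum-cong-≋ {n} (λ i → reflexive (≡.cong (expTerm y) (toℕ-inject₁ i))))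
            (reflexive (≡.cong (expTerm y) (toℕ-fromℕ n))))

  -- If `w` exceeded `z`, the gap `w - z` could serve as the tolerance, and late terms would be both
  -- within it and at least that far away.
  limit-≥ : ∀ {s z w N} → s ⟶ z → (∀ n → N ℕ.≤ n → w ≤ s n) → w ≤ z
  limit-≥ {s} {z} {w} {N} s⟶z w≤s with w ≤? z
  ... | yes w≤z = w≤z
  ... | no  w≰z = contradiction refl (proj₂ absurd)
    where
    0<w-z : 0# < w - z
    0<w-z = x≤y⇒0≤y-x (proj₁ (≰⇒> w≰z)) , λ 0≈w-z →
      w≰z (≤-reflexive (x∙y⁻¹≈ε⇒x≈y w z (sym 0≈w-z)))
    near = s⟶z (w - z) 0<w-z
    M = proj₁ near
    n = M ℕ.⊔ N
    absurd : ∣ s n - z ∣ < ∣ s n - z ∣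
    absurd = begin-strict
      ∣ s n - z ∣  <⟨ proj₂ near n (ℕₚ.m≤m⊔n M N) ⟩
      w - z        ≤⟨ +-monoˡ-≤ (- z) (w≤s n (ℕₚ.m≤n⊔m M N)) ⟩
      s n - z      ≤⟨ x≤∣x∣ (s n - z) ⟩
      ∣ s n - z ∣  ∎

  -- All terms are nonnegative, so the quadratic one alone is a lower bound; the sum of three terms
  -- is the first that contains it.
  y²/2≤expSum : ∀ {y} → 0# ≤ y → ∀ n → ½ * (y * y) ≤ expSum y (3 ℕ.+ n)
  y²/2≤expSum {y} 0≤y n = begin
    ½ * (y * y)                  ≈⟨ *-comm ½ (y * y) ⟩
    y * y * ½                    ≈⟨ *-congʳ (*-congˡ (*-identityʳ y)) ⟨
    expTerm y 2                  ≤⟨ x≤x+y (0≤sum {n} (λ i → term (suc (suc (suc (toℕ i)))))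
                                      (λ i → 0≤term (suc (suc (suc (toℕ i)))))) ⟩
    sum {suc n} (λ i → term (suc (suc (toℕ i))))  ≤⟨ x≤y+x (0≤term 1) ⟩
    sum {suc (suc n)} (λ i → term (suc (toℕ i)))  ≤⟨ x≤y+x (0≤term 0) ⟩
    expSum y (3 ℕ.+ n)           ∎
    where
    term = expTerm y
    0≤term = 0≤expTerm 0≤y

  -- Quadratic growth makes `ln` sublinear: for y ≥ 2L it yields y L ≤ y²/2 ≤ x. The linear bound
  -- e^y ≥ 1 + y would give no better than ln x ≤ x - 1.
  exp≤⇒y²/2≤ : ∀ {x y} → 0# ≤ y → Exp≤ x y → ½ * (y * y) ≤ x
  exp≤⇒y²/2≤ {y = y} 0≤y (z , lim , z≤x) = ≤-trans (limit-≥ lim bound) z≤x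
    where
    bound : ∀ n → 3 ℕ.≤ n → ½ * (y * y) ≤ expSum y n
    bound (suc zero)          (ℕ.s≤s ())
    bound (suc (suc zero))    (ℕ.s≤s (ℕ.s≤s ()))
    bound (suc (suc (suc n))) _ = y²/2≤expSum 0≤y n

  -- Sublinearity: L can be chosen large while the error term 2 L stays fixed.
  ln-sublinear : ∀ {x L} → 1# ≤ x → 0# < L → ln x ≤ (L + L) + x / L
  ln-sublinear {x} {L} 1≤x 0<L = proj₂ (ln-isSupremum x 1≤x) _ bound
    where
    0≤L = proj₁ 0<L
    0≤x/L : 0# ≤ x / L
    0≤x/L = *-nonNegative (≤-trans 0≤1 1≤x) (proj₁ (⁻¹-positive 0<L))
    bound : IsUpperBound (Exp≤ x) ((L + L) + x / L)
    bound y e^y≤x with ≤-total y (L + L)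
    ... | inj₁ y≤2L = ≤-trans y≤2L (x≤x+y 0≤x/L)
    ... | inj₂ 2L≤y = ≤-trans (x*z≤y⇒x≤y/z 0<L (begin
      y * L              ≈⟨ *-congˡ (½x+½x≈x L) ⟨
      y * (½ * L + ½ * L)  ≈⟨ *-congˡ (distribˡ ½ L L) ⟨
      y * (½ * (L + L))  ≤⟨ *-monoˡ-≤ 0≤y (*-monoˡ-≤ (proj₁ 0<½) 2L≤y) ⟩
      y * (½ * y)        ≈⟨ x∙yz≈y∙xz y ½ y ⟩
      ½ * (y * y)        ≤⟨ exp≤⇒y²/2≤ 0≤y e^y≤x ⟩
      x                  ∎)) (x≤y+x (0≤+ 0≤L 0≤L))
      where 0≤y = ≤-trans (0≤+ 0≤L 0≤L) 2L≤y

  -- An explicit rate of decay, which lets `archimedean` supply the index in `S⟶z`. Inductively, (n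
  -- + 1) ½^(n+1) is the mean of ½^n and n ½^n, both at most 1.
  n*½^n≤1 : ∀ n → fromℕ n * ½ ^ n ≤ 1#
  n*½^n≤1 zero    = ≤-respˡ-≈ (sym (zeroˡ _)) 0≤1
  n*½^n≤1 (suc n) = begin
    (1# + fromℕ n) * (½ * ½ ^ n)          ≈⟨ x∙yz≈y∙xz _ ½ _ ⟩
    ½ * ((1# + fromℕ n) * ½ ^ n)          ≈⟨ *-congˡ (distribʳ _ 1# _) ⟩
    ½ * (1# * ½ ^ n + fromℕ n * ½ ^ n)    ≤⟨ *-monoˡ-≤ (proj₁ 0<½) (+-mono-≤
                                               (≤-respˡ-≈ (sym (*-identityˡ _)) (½^≤1 n)) (n*½^n≤1 n)) ⟩
    ½ * (1# + 1#)                         ≈⟨ *-congˡ fromℕ-2 ⟨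
    ½ * fromℕ 2                           ≈⟨ ⁻¹-inverseˡ 0<2 ⟩
    1#                                    ∎
    where
    ½≤1 : ½ ≤ 1#
    ½≤1 = ≤-respʳ-≈ ½+½≈1 (x≤x+y (proj₁ 0<½))
    ½^≤1 : ∀ n → ½ ^ n ≤ 1#
    ½^≤1 zero    = ≤-refl
    ½^≤1 (suc n) = ≤-respʳ-≈ (*-identityˡ 1#) (*-mono-≤ (proj₁ 0<½) 0≤1 ½≤1 (½^≤1 n))

  -- The partial sums S n of e^½ increase while the S n + 2 (½ ^ n) decrease, so
  -- the supremum of the former is approached at the explicit rate 2 (½ ^ n).
  module ExpHalf where

    S U : ℕ → ℝ
    S n = expSum ½ n
    U n = S n + (½ ^ n + ½ ^ n)

    0≤½^ : ∀ n → 0# ≤ ½ ^ n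
    0≤½^ n = 0≤^ n (proj₁ 0<½)

    S-suc : ∀ n → S n ≤ S (suc n)
    S-suc n = ≤-respʳ-≈ (sym (expSum-suc ½ n)) (x≤x+y (0≤expTerm (proj₁ 0<½) n))

    expTerm≤½^ : ∀ n → expTerm ½ n ≤ ½ ^ n
    expTerm≤½^ n = x≤y*z⇒x/z≤y (0<! n) (≤-respˡ-≈ (*-identityʳ _)
      (*-monoˡ-≤ (0≤½^ n) (1≤fromℕ {n !} (ℕₚ.1≤n! n))))

    -- The slack `½ ^ n + ½ ^ n` is twice the next slack, so passing to `suc n` releases one
    -- `½ ^ n`, enough to absorb the new term.
    U-suc : ∀ n → U (suc n) ≤ U n
    U-suc n = begin
      S (suc n) + (½ * ½ ^ n + ½ * ½ ^ n)  ≈⟨ +-cong (expSum-suc ½ n) (½x+½x≈x (½ ^ n)) ⟩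
      (S n + expTerm ½ n) + ½ ^ n          ≤⟨ +-monoˡ-≤ (½ ^ n) (+-monoʳ-≤ (S n) (expTerm≤½^ n)) ⟩
      (S n + ½ ^ n) + ½ ^ n                ≈⟨ +-assoc _ _ _ ⟩
      U n                                  ∎

    S-+ : ∀ k n → S n ≤ S (k ℕ.+ n)
    S-+ zero    n = ≤-refl
    S-+ (suc k) n = ≤-trans (S-+ k n) (S-suc (k ℕ.+ n))

    U-+ : ∀ k n → U (k ℕ.+ n) ≤ U n
    U-+ zero    n = ≤-refl
    U-+ (suc k) n = ≤-trans (U-suc (k ℕ.+ n)) (U-+ k n)

    -- Monotonicity moves both sides to the common index `m ℕ.+ n`, where they differ by the
    -- nonnegative slack.
    S≤U : ∀ m n → S m ≤ U n
    S≤U m n = begin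
      S m            ≤⟨ S-+ n m ⟩
      S (n ℕ.+ m)    ≡⟨ ≡.cong S (ℕₚ.+-comm n m) ⟩
      S (m ℕ.+ n)    ≤⟨ x≤x+y (0≤+ (0≤½^ (m ℕ.+ n)) (0≤½^ (m ℕ.+ n))) ⟩
      U (m ℕ.+ n)    ≤⟨ U-+ m n ⟩
      U n            ∎

    Range : Pred ℝ 0ℓ
    Range x = ∃ λ n → x ≈ S n

    U-isUpperBound : ∀ n → IsUpperBound Range (U n)
    U-isUpperBound n x (m , x≈Sm) = ≤-respˡ-≈ (sym x≈Sm) (S≤U m n)

    S-supremum : ∃ (IsSupremum Range)
    S-supremum = complete Range (S 0 , 0 , refl) (U 0 , U-isUpperBound 0)

    z : ℝ
    z = proj₁ S-supremum

    S≤z : ∀ n → S n ≤ z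
    S≤z n = proj₁ (proj₂ S-supremum) (S n) (n , refl)

    z≤U : ∀ n → z ≤ U n
    z≤U n = proj₂ (proj₂ S-supremum) (U n) (U-isUpperBound n)

    z≤2 : z ≤ fromℕ 2
    -- `U 0` is the empty sum plus twice `½ ^ 0`.
    z≤2 = ≤-respʳ-≈ (trans (+-identityˡ _) (sym fromℕ-2)) (z≤U 0)

    error : ∀ n → ∣ S n - z ∣ ≤ ½ ^ n + ½ ^ n
    error n = ∣∣-≤
      (≤-trans (x≤z+y⇒x-y≤z (≤-respʳ-≈ (sym (+-identityˡ z)) (S≤z n)))
        (0≤+ (0≤½^ n) (0≤½^ n)))
      (≤-respˡ-≈ (sym (⁻¹-anti-homo‿- (S n) z)) (x≤z+y⇒x-y≤z
        (≤-respʳ-≈ (+-comm _ _) (z≤U n))))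

    S⟶z : S ⟶ z
    S⟶z ε 0<ε = suc M , λ n M<n → begin-strict
      ∣ S n - z ∣     ≤⟨ error n ⟩
      ½ ^ n + ½ ^ n   <⟨ small n M<n ⟩
      ε               ∎
      where
      M = proj₁ (archimedean (fromℕ 2 / ε))
      2≤Mε : fromℕ 2 ≤ fromℕ M * ε
      2≤Mε = x/z≤y⇒x≤y*z 0<ε (proj₂ (archimedean (fromℕ 2 / ε)))
      small : ∀ n → suc M ℕ.≤ n → ½ ^ n + ½ ^ n < ε
      -- Otherwise multiplying by n gives (M + 1) ε ≤ 2 n ½^n ≤ 2 ≤ M ε, and cancelling ε leaves 1 ≤
      -- 0.
      small n M<n = ≰⇒> λ ε≤2½^n → contradiction (≤-antisym 0≤1
        (≤-respʳ-≈ (-‿inverseʳ (fromℕ M)) (x+y≤z⇒x≤z-y (*-cancelʳ-≤ 0<ε (begin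
          fromℕ (suc M) * ε                    ≤⟨ *-monoʳ-≤ (proj₁ 0<ε) (fromℕ-mono-≤ {suc M} {n} M<n) ⟩
          fromℕ n * ε                          ≤⟨ *-monoˡ-≤ (0≤fromℕ n) ε≤2½^n ⟩
          fromℕ n * (½ ^ n + ½ ^ n)            ≈⟨ distribˡ _ _ _ ⟩
          fromℕ n * ½ ^ n + fromℕ n * ½ ^ n    ≤⟨ +-mono-≤ (n*½^n≤1 n) (n*½^n≤1 n) ⟩
          1# + 1#                              ≈⟨ fromℕ-2 ⟨
          fromℕ 2                              ≤⟨ 2≤Mε ⟩
          fromℕ M * ε                          ∎))))) 0≉1

  -- Since e^½ ≤ 2, the exponent ½ belongs to the set whose supremum is `ln x`. This keeps the
  -- logarithm away from 0 and so yields a sample size of at least 1.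
  ½≤ln : ∀ {x} → fromℕ 2 ≤ x → ½ ≤ ln x
  ½≤ln {x} 2≤x = proj₁ (ln-isSupremum x (≤-trans (1≤fromℕ {2} (ℕ.s≤s ℕ.z≤n)) 2≤x)) ½
    (z , S⟶z , ≤-trans z≤2 2≤x)
    where open ExpHalf

-- Probabilities of events about an independent random subset.

module RandomSubset (R : CompleteOrderedField) where

  open Reals R
  open OrderedFieldProperties R

  IsProbability : ∀ {n} → Vector ℝ n → Set
  IsProbability p = ∀ e → 0# ≤ p e × p e ≤ 1#

  sumSubsets-mono : ∀ n {f g : Subset n → ℝ} → (∀ S → f S ≤ g S) →
                    sumSubsets n f ≤ sumSubsets n g
  sumSubsets-mono zero    f≤g = f≤g []
  sumSubsets-mono (suc n) f≤g = +-mono-≤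
    (sumSubsets-mono n (f≤g ∘ (inside ∷_))) (sumSubsets-mono n (f≤g ∘ (outside ∷_)))

  sumSubsets-*ˡ : ∀ n x (f : Subset n → ℝ) →
                  sumSubsets n (λ S → x * f S) ≈ x * sumSubsets n f
  sumSubsets-*ˡ zero    x f = refl
  sumSubsets-*ˡ (suc n) x f = trans
    (+-cong (sumSubsets-*ˡ n x (f ∘ (inside ∷_))) (sumSubsets-*ˡ n x (f ∘ (outside ∷_))))
    (sym (distribˡ x _ _))

  0≤sumSubsets : ∀ n {f : Subset n → ℝ} → (∀ S → 0# ≤ f S) → 0# ≤ sumSubsets n f
  0≤sumSubsets zero    0≤f = 0≤f []
  0≤sumSubsets (suc n) 0≤f = 0≤+
    (0≤sumSubsets n (0≤f ∘ (inside ∷_))) (0≤sumSubsets n (0≤f ∘ (outside ∷_)))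

  weight-nonNegative : ∀ {n} {p : Vector ℝ n} → IsProbability p → ∀ S → 0# ≤ weight p S
  weight-nonNegative prob []            = 0≤1
  weight-nonNegative prob (inside  ∷ S) =
    *-nonNegative (proj₁ (prob zero)) (weight-nonNegative (prob ∘ suc) S)
  weight-nonNegative prob (outside ∷ S) =
    *-nonNegative (x≤y⇒0≤y-x (proj₂ (prob zero))) (weight-nonNegative (prob ∘ suc) S)

  sumSubsets-weight : ∀ n (p : Vector ℝ n) → sumSubsets n (weight p) ≈ 1#
  sumSubsets-weight zero    p = refl
  sumSubsets-weight (suc n) p = begin-equality
    sumSubsets n (λ S → p zero * weight (tail p) S) +
    sumSubsets n (λ S → (1# - p zero) * weight (tail p) S)
      ≈⟨ +-cong (sumSubsets-*ˡ n _ _) (sumSubsets-*ˡ n _ _) ⟩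
    p zero * sumSubsets n (weight (tail p)) + (1# - p zero) * sumSubsets n (weight (tail p))
      ≈⟨ distribʳ _ (p zero) (1# - p zero) ⟨
    (p zero + (1# - p zero)) * sumSubsets n (weight (tail p))
      ≈⟨ *-cong (trans (+-comm _ _) ([x-y]+y≈x 1# (p zero))) (sumSubsets-weight n (tail p)) ⟩
    1# * 1#
      ≈⟨ *-identityˡ 1# ⟩
    1#  ∎

  -- Only the subsets that omit element 0 and contain element 1 are kept, the other terms being
  -- nonnegative. By independence the factor for the first two elements comes out of the sum, and
  -- the weights of the remaining elements total 1.
  ℙ-outside-inside : ∀ {n} {p : Vector ℝ (2 ℕ.+ n)} → IsProbability p →
    {A : Pred (Subset (2 ℕ.+ n)) 0ℓ} (A? : Decidable A) →
    (∀ S → A (outside ∷ inside ∷ S)) →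
    (1# - p zero) * p (suc zero) ≤ ℙ p A?
  ℙ-outside-inside {n} {p} prob {A} A? A-holds = begin
    (1# - p₀) * p₁
      ≈⟨ *-identityʳ _ ⟨
    (1# - p₀) * p₁ * 1#
      ≈⟨ *-congˡ (sumSubsets-weight n rest) ⟨
    (1# - p₀) * p₁ * sumSubsets n (weight rest)
      ≈⟨ sumSubsets-*ˡ n _ _ ⟨
    sumSubsets n (λ S → (1# - p₀) * p₁ * weight rest S)
      ≤⟨ sumSubsets-mono n pointwise ⟩
    sumSubsets n (λ S → term (outside ∷ inside ∷ S))
      ≤⟨ x≤x+y (0≤sumSubsets n (λ S → 0≤term (outside ∷ outside ∷ S))) ⟩
    sumSubsets (suc n) (λ S → term (outside ∷ S))
      ≤⟨ x≤y+x (0≤sumSubsets (suc n) (λ S → 0≤term (inside ∷ S))) ⟩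
    ℙ p A?  ∎
    where
    p₀ = p zero
    p₁ = p (suc zero)
    rest = tail (tail p)
    term : Subset (2 ℕ.+ n) → ℝ
    term S = if does (A? S) then weight p S else 0#
    0≤term : ∀ S → 0# ≤ term S
    0≤term S with does (A? S)
    ... | true  = weight-nonNegative prob S
    ... | false = ≤-refl
    pointwise : ∀ S → (1# - p₀) * p₁ * weight rest S ≤ term (outside ∷ inside ∷ S)
    pointwise S rewrite dec-true (A? (outside ∷ inside ∷ S)) (A-holds S) =
      ≤-reflexive (*-assoc (1# - p₀) p₁ (weight rest S))

-- Silhouette values when one of a, b is at least twice the other.

module SilhouetteBounds (R : CompleteOrderedField) where

  open Reals R
  open OrderedFieldProperties R
  open NaturalMax totalOrder using (x≤y⇒x⊔y≈y; x≤y⇒y⊔x≈y)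
  open RingProperties ring using (-‿distribˡ-*; -‿involutive)

  x+x≤y⇒x≤½y : ∀ {x y} → x + x ≤ y → x ≤ ½ * y
  x+x≤y⇒x≤½y {x} {y} 2x≤y = begin
    x                ≈⟨ ½x+½x≈x x ⟨
    ½ * x + ½ * x    ≈⟨ distribˡ ½ x x ⟨
    ½ * (x + x)      ≤⟨ *-monoˡ-≤ (proj₁ 0<½) 2x≤y ⟩
    ½ * y            ∎

  ½x≤x : ∀ {x} → 0# ≤ x → ½ * x ≤ x
  ½x≤x {x} 0≤x = ≤-respʳ-≈ (½x+½x≈x x) (x≤x+y (*-nonNegative (proj₁ 0<½) 0≤x))

  ½x≈x-½x : ∀ x → ½ * x ≈ x - ½ * x
  ½x≈x-½x x = trans (sym ([x+y]-y≈x (½ * x) (½ * x))) (+-congʳ (½x+½x≈x x))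

  -- The maximum is `b`, so the quotient is 1 - a / b. The factor 2, here and in the mirror image
  -- `silhouette-≤-½`, is what separates the two values by 1.
  silhouette-≥½ : ∀ {a b} → 0# < b → a + a ≤ b → ½ ≤ (b - a) / (a ⊔ b)
  silhouette-≥½ {a} {b} 0<b 2a≤b =
    x*z≤y⇒x≤y/z (<-≤-trans 0<b (≤-reflexive (sym a⊔b≈b))) (begin
      ½ * (a ⊔ b)   ≈⟨ *-congˡ a⊔b≈b ⟩
      ½ * b         ≈⟨ ½x≈x-½x b ⟩
      b - ½ * b     ≤⟨ +-monoʳ-≤ b (neg-antimono-≤ a≤½b) ⟩
      b - a         ∎)
    where
    a≤½b = x+x≤y⇒x≤½y 2a≤b
    a⊔b≈b = x≤y⇒x⊔y≈y (≤-trans a≤½b (½x≤x (proj₁ 0<b)))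

  silhouette-≤-½ : ∀ {a b} → 0# < a → b + b ≤ a → (b - a) / (a ⊔ b) ≤ - ½
  silhouette-≤-½ {a} {b} 0<a 2b≤a =
    x≤y*z⇒x/z≤y (<-≤-trans 0<a (≤-reflexive (sym a⊔b≈a))) (begin
      b - a              ≤⟨ +-monoˡ-≤ (- a) b≤½a ⟩
      ½ * a - a          ≈⟨ ⁻¹-anti-homo‿- a (½ * a) ⟨
      - (a - ½ * a)      ≈⟨ -‿cong (½x≈x-½x a) ⟨
      - (½ * a)          ≈⟨ -‿distribˡ-* ½ a ⟩
      - ½ * a            ≈⟨ *-congˡ a⊔b≈a ⟨
      - ½ * (a ⊔ b)      ∎)
    where
    open AbelianGroupProperties +-abelianGroup using (⁻¹-anti-homo‿-)
    b≤½a = x+x≤y⇒x≤½y 2b≤a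
    a⊔b≈a = x≤y⇒y⊔x≈y (≤-trans b≤½a (½x≤x (proj₁ 0<a)))

  1≤∣x-y∣ : ∀ {x y} → ½ ≤ x → y ≤ - ½ → 1# ≤ ∣ x - y ∣
  1≤∣x-y∣ {x} {y} ½≤x y≤-½ = begin
    1#           ≈⟨ ½+½≈1 ⟨
    ½ + ½        ≈⟨ +-congˡ (-‿involutive ½) ⟨
    ½ - - ½      ≤⟨ +-mono-≤ ½≤x (neg-antimono-≤ y≤-½) ⟩
    x - y        ≤⟨ x≤∣x∣ (x - y) ⟩
    ∣ x - y ∣    ∎

-- The ultrametric induced by a rank function.

module RankUltrametric (R : CompleteOrderedField) {n : ℕ} (rank : Fin n → ℕ) where

  open Reals R
  open OrderedFieldProperties R

  -- When all ranks are positive, a point of rank 1 sees every other point at a distance equal to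
  -- that point's rank, so these distances can be prescribed freely. Values in ℕ allow the metric
  -- axioms to be checked there and transferred by `fromℕ`.
  δ : Fin n → Fin n → ℕ
  δ i j = if does (i Fin.≟ j) then 0 else rank i ℕ.⊔ rank j

  δ-refl : ∀ i → δ i i ≡ 0
  δ-refl i rewrite dec-true (i Fin.≟ i) ≡.refl = ≡.refl

  δ-≢ : ∀ {i j} → ¬ (i ≡ j) → δ i j ≡ rank i ℕ.⊔ rank j
  δ-≢ {i} {j} i≢j rewrite dec-false (i Fin.≟ j) i≢j = ≡.refl

  δ-≤ : ∀ i j → δ i j ℕ.≤ rank i ℕ.⊔ rank j
  δ-≤ i j with does (i Fin.≟ j)
  ... | true  = ℕ.z≤n
  ... | false = ℕₚ.≤-refl

  δ-sym : ∀ i j → δ i j ≡ δ j i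
  δ-sym i j with i Fin.≟ j
  ... | yes ≡.refl = ≡.sym (δ-refl i)
  ... | no  i≢j    = ≡.trans (ℕₚ.⊔-comm (rank i) (rank j)) (≡.sym (δ-≢ (i≢j ∘ ≡.sym)))

  -- If `j` differs from both ends, the first summand is at least the rank of `i` and the second at
  -- least the rank of `k`, hence their sum is at least the larger of the two.
  δ-triangle : ∀ i j k → δ i k ℕ.≤ δ i j ℕ.+ δ j k
  δ-triangle i j k with i Fin.≟ j | j Fin.≟ k
  ... | yes ≡.refl | no  j≢k    = ℕₚ.≤-reflexive (δ-≢ j≢k)
  ... | yes ≡.refl | yes ≡.refl = ℕₚ.≤-reflexive (δ-refl i)
  ... | no  i≢j    | yes ≡.refl = ℕₚ.≤-trans (ℕₚ.≤-reflexive (δ-≢ i≢j)) (ℕₚ.m≤m+n _ 0)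
  ... | no  _      | no  _      = ℕₚ.≤-trans (δ-≤ i k) (ℕₚ.⊔-lub
    (ℕₚ.≤-trans (ℕₚ.m≤m⊔n (rank i) (rank j)) (ℕₚ.m≤m+n _ _))
    (ℕₚ.≤-trans (ℕₚ.m≤n⊔m (rank j) (rank k)) (ℕₚ.m≤n+m _ _)))

  module _ (rank-positive : ∀ i → 1 ℕ.≤ rank i) where

    δ≡0⇒≡ : ∀ i j → δ i j ≡ 0 → i ≡ j
    δ≡0⇒≡ i j with i Fin.≟ j
    ... | yes i≡j = λ _ → i≡j
    ... | no  _   = λ p → contradiction (≡.subst (1 ℕ.≤_) p
      (ℕₚ.≤-trans (rank-positive i) (ℕₚ.m≤m⊔n (rank i) (rank j)))) (λ ())

    metricSpace : MetricSpace
    metricSpace = record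
      { Carrier  = Fin n
      ; _≃_      = _≡_
      ; d        = λ i j → fromℕ (δ i j)
      ; isMetric = record
        { isSemiMetric = record
          { isQuasiSemiMetric = record
            { isPreMetric = record
              { isProtoMetric = record
                { isPartialOrder  = Bundles.TotalOrder.isPartialOrder totalOrder
                ; ≈-isEquivalence = ≡.isEquivalence
                ; cong            = λ { ≡.refl ≡.refl → refl }
                ; nonNegative     = λ {i} {j} → 0≤fromℕ (δ i j)
                }
              ; ≈⇒0 = λ { {i} ≡.refl → reflexive (≡.cong fromℕ (δ-refl i)) }
              }
            ; 0⇒≈ = λ {i} {j} p → δ≡0⇒≡ i j (fromℕ≈0⇒≡0 (δ i j) p)
            }
          ; sym = λ i j → reflexive (≡.cong fromℕ (δ-sym i j))
          }
        ; triangle = λ i j k → ≤-respʳ-≈ (fromℕ-+ (δ i j) (δ j k))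
            (fromℕ-mono-≤ (δ-triangle i j k))
        }
      }

-- The dataset with an outlier and its exact and estimated silhouettes.

module OutlierDataset (R : CompleteOrderedField) (r : ℕ) where

  open Reals R
  open OrderedFieldProperties R
  open RandomSubset R
  open SilhouetteBounds R
  open NaturalMin totalOrder using (x⊓y≤x; x⊓y≤y; ⊓-glb; ⊓-sel)

  -- `q` is a successor so that `M` is positive and a(e), which divides by the cluster size less
  -- one, has the positive divisor `q`. `m` is the size of the first cluster.
  q m D M : ℕ
  q = suc r
  m = suc q
  D = m ℕ.+ m
  M = (D ℕ.+ D) ℕ.* q

  -- Point 0 is the outlier, point 1 the singleton cluster and the remaining q
  -- points are at mutual distance 1.  M = 2 D q alone makes a ≥ 2 b; without the
  -- outlier â ≤ 1 / p₀ ≤ m = D / 2.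
  rank : Fin (2 ℕ.+ q) → ℕ
  rank zero          = M
  rank (suc zero)    = D
  rank (suc (suc _)) = 1

  rank-positive : ∀ i → 1 ℕ.≤ rank i
  rank-positive zero          = ℕ.s≤s ℕ.z≤n
  rank-positive (suc zero)    = ℕ.s≤s ℕ.z≤n
  rank-positive (suc (suc _)) = ℕ.s≤s ℕ.z≤n

  open RankUltrametric R rank

  U : MetricSpace
  U = metricSpace rank-positive

  V : Dataset U (2 ℕ.+ q)
  V = record { point = λ i → i ; distinct = λ i≡j → i≡j }

  -- With the outlier and the singleton in the first two positions, the decisive event is the
  -- pattern `outside ∷ inside ∷ S`, and sums over a cluster compute down to the tail of `q` points.
  cluster : Fin 2 → Subset (2 ℕ.+ q)
  cluster zero       = inside  ∷ outside ∷ ⊤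
  cluster (suc zero) = outside ∷ inside  ∷ ⊥

  disjoint : ∀ {i j e} → e ∈ cluster i → e ∈ cluster j → i ≡ j
  disjoint {zero}     {zero}     _ _ = ≡.refl
  disjoint {suc zero} {suc zero} _ _ = ≡.refl
  disjoint {zero}     {suc zero} (there (there _)) (there (there e∈⊥)) =
    contradiction e∈⊥ ∉⊥
  disjoint {suc zero} {zero}     (there (there e∈⊥)) (there (there _)) =
    contradiction e∈⊥ ∉⊥

  C : Clustering (2 ℕ.+ q) 2
  C = record
    { cluster  = cluster
    ; nonempty = λ { zero → zero , here ; (suc zero) → suc zero , there here }
    ; disjoint = disjoint
    ; covers   = λ
      { zero          → zero , here
      ; (suc zero)    → suc zero , there here
      ; (suc (suc e)) → zero , there (there ∈⊤)
      }
    }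

  open Dataset V
  open Clustering C using (size; clusterOf)
  open Silhouette V C

  size₀≡m : size zero ≡ m
  size₀≡m = ≡.cong suc (∣⊤∣≡n q)

  size₁≡1 : size (suc zero) ≡ 1
  size₁≡1 = ≡.cong suc (∣⊥∣≡0 q)

  1≤size : ∀ j → 1 ℕ.≤ size j
  1≤size zero       = ℕ.s≤s ℕ.z≤n
  1≤size (suc zero) = ℕ.s≤s ℕ.z≤n

  0<size : ∀ j → 0# < fromℕ (size j)
  0<size j = 0<fromℕ {size j} (1≤size j)

  /size₁ : ∀ x → x / fromℕ (size (suc zero)) ≈ x
  /size₁ x = trans (reflexive (≡.cong (λ k → x / fromℕ k) size₁≡1)) (x/1≈x x)

  0≤dist : ∀ i j → 0# ≤ dist i j
  0≤dist i j = 0≤fromℕ (δ i j)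

  fromℕD : fromℕ D ≈ fromℕ m + fromℕ m
  fromℕD = fromℕ-+ m m

  s-≤-½ : ∀ e → s (suc (suc e)) ≤ - ½
  s-≤-½ e = silhouette-≤-½ 0<a 2b≤a
    where
    open From (W (suc (suc e))) (suc (suc e)) using (a; b)
    -- There is just one other cluster, so the minimum is its only entry by computation.
    b≈D : b ≈ fromℕ D
    b≈D = trans (/size₁ _) (trans (+-identityˡ _)
      (trans (+-congˡ (sumOver-⊥ q (λ i → dist (suc (suc e)) (suc (suc i)))))
        (+-identityʳ (fromℕ D))))
    2b≤a : b + b ≤ a
    2b≤a = begin
      b + b              ≈⟨ +-cong b≈D b≈D ⟩
      fromℕ D + fromℕ D  ≤⟨ x*z≤y⇒x≤y/z (0<fromℕ {size zero ℕ.∸ 1} (ℕ.s≤s ℕ.z≤n)) (begin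
        (fromℕ D + fromℕ D) * fromℕ (size zero ℕ.∸ 1)
          ≈⟨ *-congʳ (fromℕ-+ D D) ⟨
        fromℕ (D ℕ.+ D) * fromℕ (size zero ℕ.∸ 1)
          ≡⟨ ≡.cong (λ k → fromℕ (D ℕ.+ D) * fromℕ (k ℕ.∸ 1)) size₀≡m ⟩
        fromℕ (D ℕ.+ D) * fromℕ q
          ≈⟨ fromℕ-* (D ℕ.+ D) q ⟨
        -- Of the distances to the own cluster only the one to the outlier is kept.
        fromℕ M
          ≤⟨ x≤x+y (0≤+ ≤-refl (0≤sumOver (⊤ {q}) (λ i → 0≤dist (suc (suc e)) (suc (suc i))))) ⟩
        W (suc (suc e)) zero ∎) ⟩
      a                  ∎
    0<a : 0# < a
    0<a = <-≤-trans 0<b+b 2b≤a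
      where
      0<b : 0# < b
      0<b = <-≤-trans (0<fromℕ {D} (ℕ.s≤s ℕ.z≤n)) (≤-reflexive (sym b≈D))
      0<b+b = <-≤-trans 0<b (x≤x+y (proj₁ 0<b))

  module _ (t : ℕ) (1≤t : 1 ℕ.≤ t) where

    open Sampling t

    -- The minimum equals one of its arguments only up to `≈`, hence the requirement that `P`
    -- respect it.
    p-sel : ∀ j {P : ℝ → Set} → (∀ {x y} → x ≈ y → P x → P y) →
            P 1# → P (fromℕ t / fromℕ (size j)) → P (p j)
    p-sel j resp P1 Pt/s with ⊓-sel 1# (fromℕ t / fromℕ (size j))
    ... | inj₁ p≈1   = resp (sym p≈1) P1
    ... | inj₂ p≈t/s = resp (sym p≈t/s) Pt/s

    p-positive : ∀ j → 0# < p j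
    p-positive j = p-sel j (λ x≈y 0<x → <-≤-trans 0<x (≤-reflexive x≈y)) 0<1
      (*-positive (0<fromℕ {t} 1≤t) (⁻¹-positive (0<size j)))

    p≤1 : ∀ j → p j ≤ 1#
    p≤1 j = x⊓y≤x 1# _

    -- The expected sample size is either the whole size or `t`. This caps the scaling factor 1 / p
    -- by the cluster size.
    1≤size*p : ∀ j → 1# ≤ fromℕ (size j) * p j
    1≤size*p j = p-sel j (λ x≈y → ≤-respʳ-≈ (*-congˡ x≈y))
      (≤-respʳ-≈ (sym (*-identityʳ _)) (1≤fromℕ {size j} (1≤size j)))
      (≤-respʳ-≈ (trans (sym (/-*-cancelʳ (fromℕ t) (0<size j))) (*-comm _ _))
        (1≤fromℕ {t} 1≤t))

    ŝ-≥½ : ∀ S e → ½ ≤ ŝ (outside ∷ inside ∷ S) (suc (suc e))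
    ŝ-≥½ S e = silhouette-≥½ (<-≤-trans (0<fromℕ {D} (ℕ.s≤s ℕ.z≤n)) D≤b) (begin
        a + a              ≤⟨ +-mono-≤ a≤m a≤m ⟩
        fromℕ m + fromℕ m  ≈⟨ fromℕD ⟨
        fromℕ D            ≤⟨ D≤b ⟩
        b                  ∎)
      where
      open From (Ŵ (outside ∷ inside ∷ S) (suc (suc e))) (suc (suc e)) using (a; b)
      D≤b : fromℕ D ≤ b
      D≤b = begin
        -- The sampled singleton contributes its distance divided by a probability, which can only
        -- enlarge it.
        fromℕ D                               ≤⟨ x*z≤y⇒x≤y/z (p-positive (suc zero)) (begin
          fromℕ D * p (suc zero)                ≤⟨ *-monoˡ-≤ (0≤fromℕ D) (p≤1 (suc zero)) ⟩
          fromℕ D * 1#                          ≈⟨ *-identityʳ (fromℕ D) ⟩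
          fromℕ D                               ∎) ⟩
        fromℕ D / p (suc zero)                ≤⟨ x≤x+y (0≤sumOver (S ∩ ⊥) (λ i →
                                                   *-nonNegative (0≤dist (suc (suc e)) (suc (suc i)))
                                                     (proj₁ (⁻¹-positive (p-positive (suc zero)))))) ⟩
        _                                     ≈⟨ +-identityˡ _ ⟨
        Ŵ (outside ∷ inside ∷ S) (suc (suc e)) (suc zero)
                                              ≈⟨ /size₁ _ ⟨
        b                                     ∎
      summand≤m : ∀ i → dist (suc (suc e)) (suc (suc i)) / p zero ≤ fromℕ m
      summand≤m i = x≤y*z⇒x/z≤y (p-positive zero) (begin
        dist (suc (suc e)) (suc (suc i))  ≤⟨ fromℕ-mono-≤ (δ-≤ (suc (suc e)) (suc (suc i))) ⟩
        fromℕ 1                           ≈⟨ fromℕ-1 ⟩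
        1#                                ≤⟨ 1≤size*p zero ⟩
        fromℕ (size zero) * p zero        ≡⟨ ≡.cong (λ k → fromℕ k * p zero) size₀≡m ⟩
        fromℕ m * p zero                  ∎)
      a≤m : a ≤ fromℕ m
      -- Even if all `q` points are sampled, there are `q` summands of at most `m` each and the
      -- divisor is `q`.
      a≤m = x≤y*z⇒x/z≤y (0<fromℕ {size zero ℕ.∸ 1} (ℕ.s≤s ℕ.z≤n)) (begin
        Ŵ (outside ∷ inside ∷ S) (suc (suc e)) zero
          ≈⟨ trans (+-identityˡ _) (+-identityˡ _) ⟩
        sumOver (S ∩ ⊤) (λ i → dist (suc (suc e)) (suc (suc i)) / p zero)
          ≤⟨ sumOver-≤ (S ∩ ⊤) (0≤fromℕ m) summand≤m ⟩
        fromℕ q * fromℕ m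
          ≈⟨ *-comm (fromℕ q) (fromℕ m) ⟩
        fromℕ m * fromℕ q
          ≡⟨ ≡.cong (λ k → fromℕ m * fromℕ (k ℕ.∸ 1)) size₀≡m ⟨
        fromℕ m * fromℕ (size zero ℕ.∸ 1) ∎)

    -- The errors at the outlier and at the singleton are left open: their two entries are simply
    -- dropped from the count.
    largeError-card : ∀ S → q ℕ.≤ card (largeError (outside ∷ inside ∷ S))
    largeError-card S = ℕₚ.≤-trans
      (card-tabulate (λ e → isLarge (suc (suc e))) (λ e → dec-true (1# ≤? _)
        (1≤∣x-y∣ (ŝ-≥½ S e) (s-≤-½ e))))
      (ℕₚ.≤-trans (∣p∣≤∣x∷p∣ (isLarge (suc zero)) (Vec.tabulate (λ e → isLarge (suc (suc e)))))
        (∣p∣≤∣x∷p∣ (isLarge zero) (Vec.tabulate (isLarge ∘ suc))))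
      where
      isLarge : Fin (2 ℕ.+ q) → Bool
      isLarge e = does (1# ≤? ∣ ŝ (outside ∷ inside ∷ S) e - s e ∣)

    manyLargeErrors : ∀ S → ManyLargeErrors (outside ∷ inside ∷ S)
    manyLargeErrors S = x≤z+y⇒x-y≤z (x≤y*z⇒x/z≤y 0<2 (begin
      1# + fromℕ m                              ≈⟨ +-comm 1# (fromℕ m) ⟩
      -- The dataset has m + 1 points and m + 1 ≤ 2 m = 2 (q + 1), so half its size less one is at
      -- most `q`.
      fromℕ m + 1#                              ≤⟨ +-monoʳ-≤ (fromℕ m) (1≤fromℕ {m} (ℕ.s≤s ℕ.z≤n)) ⟩
      fromℕ m + fromℕ m                         ≈⟨ *2≈ (fromℕ m) ⟨
      fromℕ m * fromℕ 2                         ≈⟨ *-congʳ (+-comm 1# (fromℕ q)) ⟩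
      (fromℕ q + 1#) * fromℕ 2                  ≤⟨ *-monoʳ-≤ (proj₁ 0<2)
                                                     (+-monoˡ-≤ 1# (fromℕ-mono-≤ (largeError-card S))) ⟩
      (fromℕ (card (largeError (outside ∷ inside ∷ S))) + 1#) * fromℕ 2  ∎))

    ℙ-manyLargeErrors : ∀ {η} → fromℕ t ≤ η * fromℕ m → η < 1# →
                        1# - η ≤ ℙ inclusion manyLargeErrors?
    ℙ-manyLargeErrors {η} t≤ηm (η≤1 , _) = begin
      1# - η                         ≤⟨ +-monoʳ-≤ 1# (neg-antimono-≤ p₀≤η) ⟩
      1# - p zero                    ≈⟨ *-identityʳ _ ⟨
      (1# - p zero) * 1#             ≤⟨ *-monoˡ-≤ (x≤y⇒0≤y-x (p≤1 zero)) 1≤p₁ ⟩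
      (1# - p zero) * p (suc zero)   ≤⟨ ℙ-outside-inside {p = inclusion}
                                          (λ e → proj₁ (p-positive (clusterOf e)) , p≤1 (clusterOf e))
                                          manyLargeErrors? manyLargeErrors ⟩
      ℙ inclusion manyLargeErrors?   ∎
      where
      p₀≤η : p zero ≤ η
      p₀≤η = ≤-trans (x⊓y≤y 1# _) (x≤y*z⇒x/z≤y (0<size zero)
        (≡.subst (λ k → fromℕ t ≤ η * fromℕ k) (≡.sym size₀≡m) t≤ηm))
      1≤p₁ : 1# ≤ p (suc zero)
      1≤p₁ = ⊓-glb ≤-refl (≤-respʳ-≈ (sym (/size₁ (fromℕ t))) (1≤fromℕ {t} 1≤t))

-- Taking the sample size as a function of n resolves the circular dependence: `r` fixes the
-- dataset, and the function is then evaluated at the resulting size `suc m`. The logarithm enters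
-- only through the two bounds on that value.
sampling-fails : (R : CompleteOrderedField) (r : ℕ) →
  let open Reals R in let m = 2 ℕ.+ r in
  (t : ℕ → ℕ) {N : ℕ} → N ℕ.≤ suc m → 1 ℕ.≤ t (suc m) →
  ∀ {η} → fromℕ (t (suc m)) ≤ η * fromℕ m → η < 1# →
  Σ[ n ∈ ℕ ] (N ℕ.≤ n ×
    (Σ[ U ∈ MetricSpace ] Σ[ V ∈ Dataset U n ] Σ[ C ∈ Clustering n 2 ]
      (let open Silhouette V C
           open Sampling (t n)
       in 1# - η ≤ ℙ inclusion manyLargeErrors?)))
sampling-fails R r t N≤n 1≤t t≤ηm η<1 =
  suc m , N≤n , U , V , C , ℙ-manyLargeErrors (t (suc m)) 1≤t t≤ηm η<1
  where open OutlierDataset R r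

-- A dataset size that outgrows the logarithmic sample size.

module SampleSize (R : CompleteOrderedField) where

  open Reals R
  open OrderedFieldProperties R
  open Logarithm R using (½≤ln; ln-sublinear)

  module Parameters
    (κ X η : ℝ) (0<κ : 0# < κ) (0<X : 0# < X) (0<η : 0# < η) (N : ℕ)
    where

    -- Solves κ X / L = ½ η, so that the linear part of the bound on κ ln y consumes exactly half of
    -- the allowance η m. It is independent of `m`, which can therefore be chosen afterwards.
    L : ℝ
    L = κ * X / (½ * η)

    0<½η : 0# < ½ * η
    0<½η = *-positive 0<½ 0<η

    0<L : 0# < L
    0<L = *-positive (*-positive 0<κ 0<X) (⁻¹-positive 0<½η)

    -- `m₀` is large enough for the other half of the allowance to cover the constant 1 + 2 κ L,
    -- where the 1 comes from rounding up; adding `N` makes the dataset as large as demanded.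
    m₀ r m : ℕ
    m₀ = proj₁ (archimedean ((1# + κ * (L + L)) / (½ * η)))
    r  = N ℕ.+ m₀
    m  = 2 ℕ.+ r

    constant≤ : 1# + κ * (L + L) ≤ ½ * η * fromℕ m
    constant≤ = begin
      1# + κ * (L + L)       ≤⟨ x/z≤y⇒x≤y*z 0<½η (proj₂ (archimedean _)) ⟩
      fromℕ m₀ * (½ * η)     ≤⟨ *-monoʳ-≤ (proj₁ 0<½η) (fromℕ-mono-≤ {m₀} {m}
                                  (ℕₚ.≤-trans (ℕₚ.m≤n+m m₀ N) (ℕₚ.m≤n+m r 2))) ⟩
      fromℕ m * (½ * η)      ≈⟨ *-comm (fromℕ m) (½ * η) ⟩
      ½ * η * fromℕ m        ∎

    module _ {y : ℝ} (2≤y : fromℕ 2 ≤ y) (y≤Xm : y ≤ X * fromℕ m) where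

      linear≤ : κ * (y / L) ≤ ½ * η * fromℕ m
      linear≤ = ≤-respˡ-≈ (*-assoc κ y (L ⁻¹)) (x≤y*z⇒x/z≤y 0<L (begin
        κ * y                      ≤⟨ *-monoˡ-≤ (proj₁ 0<κ) y≤Xm ⟩
        κ * (X * fromℕ m)          ≈⟨ *-assoc κ X (fromℕ m) ⟨
        κ * X * fromℕ m            ≈⟨ *-congʳ (/-*-cancelʳ (κ * X) 0<½η) ⟨
        L * (½ * η) * fromℕ m      ≈⟨ *-assoc L (½ * η) (fromℕ m) ⟩
        L * (½ * η * fromℕ m)      ≈⟨ *-comm L (½ * η * fromℕ m) ⟩
        ½ * η * fromℕ m * L        ∎))

      t : ℕ
      t = ⌈ κ * ln y ⌉

      1≤y : 1# ≤ y
      1≤y = ≤-trans (1≤fromℕ {2} (ℕ.s≤s ℕ.z≤n)) 2≤y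

      0<ln : 0# < ln y
      0<ln = <-≤-trans 0<½ (½≤ln 2≤y)

      1≤t : 1 ℕ.≤ t
      1≤t = ⌈⌉-positive (κ * ln y) (*-positive 0<κ 0<ln)

      t≤ηm : fromℕ t ≤ η * fromℕ m
      t≤ηm = begin
        fromℕ t                                  ≤⟨ ⌈⌉-≤ (κ * ln y) (*-nonNegative (proj₁ 0<κ) (proj₁ 0<ln)) ⟩
        1# + κ * ln y                            ≤⟨ +-monoʳ-≤ 1# (*-monoˡ-≤ (proj₁ 0<κ) (ln-sublinear 1≤y 0<L)) ⟩
        1# + κ * ((L + L) + y / L)               ≈⟨ +-congˡ (distribˡ κ (L + L) (y / L)) ⟩
        1# + (κ * (L + L) + κ * (y / L))         ≈⟨ +-assoc 1# (κ * (L + L)) (κ * (y / L)) ⟨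
        (1# + κ * (L + L)) + κ * (y / L)         ≤⟨ +-mono-≤ constant≤ linear≤ ⟩
        ½ * η * fromℕ m + ½ * η * fromℕ m        ≈⟨ distribʳ (fromℕ m) (½ * η) (½ * η) ⟨
        (½ * η + ½ * η) * fromℕ m                ≈⟨ *-congʳ (½x+½x≈x η) ⟩
        η * fromℕ m                              ∎

theorem2 :
    (R : CompleteOrderedField) →
    let open Reals R in
    (ε δ : ℝ) → 0# < ε → ε < 1# → 0# < δ → δ < 1# →
    (c : ℝ) → 0# < c →
    (η : ℝ) → 0# < η → η < 1# → (N : ℕ) →
    Σ[ n ∈ ℕ ] (N ℕ.≤ n ×
      (Σ[ U ∈ MetricSpace ] Σ[ V ∈ Dataset U n ] Σ[ C ∈ Clustering n 2 ]
        (let open Silhouette V C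
             t = ⌈ c * (ε ^ 2) ⁻¹ * ln (fromℕ (5 ℕ.* n ℕ.* k) / δ) ⌉
             open Sampling t
         in 1# - η ≤ ℙ inclusion manyLargeErrors?)))
theorem2 R ε δ 0<ε _ 0<δ (δ≤1 , _) c 0<c η 0<η η<1 N =
  sampling-fails R r (λ n → ⌈ c * (ε ^ 2) ⁻¹ * ln (fromℕ (5 ℕ.* n ℕ.* 2) / δ) ⌉)
    N≤n (1≤t 2≤y y≤Xm) (t≤ηm 2≤y y≤Xm) η<1
  where
  open Reals R
  open OrderedFieldProperties R
  a : ℕ
  -- The extra factor 2 turns n = m + 1 into a multiple of m, through m + 1 ≤ 2 m.
  a = 5 ℕ.* (2 ℕ.* 2)
  0<ε² : 0# < ε ^ 2
  0<ε² = *-positive 0<ε (*-positive 0<ε 0<1)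
  0<X : 0# < fromℕ a / δ
  0<X = *-positive (0<fromℕ {a} (ℕ.s≤s ℕ.z≤n)) (⁻¹-positive 0<δ)
  open SampleSize.Parameters R (c * (ε ^ 2) ⁻¹) (fromℕ a / δ) η
    (*-positive 0<c (⁻¹-positive 0<ε²)) 0<X 0<η N using (r; m; 1≤t; t≤ηm)
  N≤n : N ℕ.≤ suc m
  N≤n = ℕₚ.≤-trans (ℕₚ.m≤m+n N _) (ℕₚ.m≤n+m r 3)
  -- The threshold 2 is the one from which `½≤ln` applies.
  2≤y : fromℕ 2 ≤ fromℕ (5 ℕ.* suc m ℕ.* 2) / δ
  2≤y = x≤y⇒x≤y/δ 0<δ δ≤1 (0≤fromℕ 2) (fromℕ-mono-≤ {2} {5 ℕ.* suc m ℕ.* 2}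
    (ℕₚ.*-monoˡ-≤ 2 {1} {5 ℕ.* suc m} (ℕ.s≤s ℕ.z≤n)))
  y≤Xm : fromℕ (5 ℕ.* suc m ℕ.* 2) / δ ≤ fromℕ a / δ * fromℕ m
  y≤Xm = fromℕ/δ-≤ a m 0<δ (m*[1+n]*o≤m*[2*o]*n 5 m 2 (ℕ.s≤s ℕ.z≤n))
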